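{- Exhaustible and searchable sets are closed under the formation of computable images. That is, let $D,D'$ be domains, let $f\in(D\to D')$ be computable and let $K\subseteq D$. If $K$ is exhaustible then so is $f(K)\subseteq D'$, and if $K$ is searchable then so is $f(K)\subseteq D'$.
   Context: Domains are the objects of a fixed cartesian closed category of effectively given domains (for instance effectively given Scott domains, i.e. algebraic, bounded complete, directed complete posets), containing the flat domain $\mathcal{B}=\{0,1,\bot\}$ of booleans. $(D\to E)$ denotes the domain of Scott continuous maps ordered pointwise. "Computable" is meant in the standard sense for effectively given domains; computable maps are continuous. A predicate $p\in(D\to\mathcal{B})$ is defined on $K\subseteq D$ if $p(x)\neq\bot$ for all $x\in K$. $K$ is exhaustible if there is a computable $\forall_K:(D\to\mathcal{B})\to\mathcal{B}$ such that for every $p$ defined on $K$, $\forall_K(p)=1$ if $p(x)=1$ for all $x\in K$, and $\forall_K(p)=0$ if $p(x)=0$ for some $x\in K$. $K$ is searchable if there is a computable $\varepsilon_K:(D\to\mathcal{B})\to D$ such that for every $p$ defined on $K$: $\varepsilon_K(p)\in K$, and $p(\varepsilon_K(p))=1$ if $p(x)=1$ for some $x\in K$. -}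

module Defs where

open import Level using (Level; 0ℓ; _⊔_) renaming (suc to lsuc)
open import Data.Bool.Base using (Bool; true; false)
open import Data.Empty using (⊥)
open import Data.Fin.Base using (Fin)
open import Data.Nat.Base using (ℕ; zero; suc; _<_)
open import Data.Product.Base using (Σ; ∃-syntax; Σ-syntax; _×_; _,_; proj₁; proj₂)
open import Data.Product.Relation.Binary.Pointwise.NonDependent using (×-poset)
open import Data.Sum.Base using (_⊎_; inj₁; inj₂)
open import Data.Unit.Polymorphic.Base using (tt)
open import Data.Unit.Polymorphic.Properties using (≡-poset)
open import Data.Vec.Base using (Vec; []; _∷_; lookup)
open import Function.Base using (_∘_)
open import Function.Bundles using (_⇔_)
open import Relation.Binary.Bundles using (Poset)
open import Relation.Binary.Core using (Rel)
open import Relation.Binary.PropositionalEquality.Core using (_≡_; refl; subst)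
open import Relation.Nullary.Negation.Core using (¬_)
open import Relation.Unary using (Pred)

data Rec : ℕ → Set where
  zer  : ∀ {n} → Rec n
  succ : Rec 1
  proj : ∀ {n} → Fin n → Rec n
  comp : ∀ {m n} → Rec m → Vec (Rec n) m → Rec n
  prec : ∀ {n} → Rec n → Rec (suc (suc n)) → Rec (suc n)
  mu   : ∀ {n} → Rec (suc n) → Rec n

infix 4 _[_]⇓_ _[_]⇓*_

-- r [ v ]⇓ y: the partial recursive function coded by r is defined at v,
-- with value y.
mutual
  data _[_]⇓_ : ∀ {n} → Rec n → Vec ℕ n → ℕ → Set where
    zer⇓   : ∀ {n} {v : Vec ℕ n} → zer [ v ]⇓ 0
    succ⇓  : ∀ {x} → succ [ x ∷ [] ]⇓ suc x
    proj⇓  : ∀ {n} {v : Vec ℕ n} (i : Fin n) → proj i [ v ]⇓ lookup v i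
    comp⇓  : ∀ {m n} {f : Rec m} {gs : Vec (Rec n) m} {v w y} →
             gs [ v ]⇓* w → f [ w ]⇓ y → comp f gs [ v ]⇓ y
    prec⇓₀ : ∀ {n} {f : Rec n} {g v y} →
             f [ v ]⇓ y → prec f g [ 0 ∷ v ]⇓ y
    prec⇓ₛ : ∀ {n} {f : Rec n} {g x v y z} →
             prec f g [ x ∷ v ]⇓ y → g [ x ∷ y ∷ v ]⇓ z →
             prec f g [ suc x ∷ v ]⇓ z
    mu⇓    : ∀ {n} {f : Rec (suc n)} {v x} →
             (∀ i → i < x → ∃[ y ] f [ i ∷ v ]⇓ suc y) → f [ x ∷ v ]⇓ 0 →
             mu f [ v ]⇓ x

  data _[_]⇓*_ {n} : ∀ {m} → Vec (Rec n) m → Vec ℕ n → Vec ℕ m → Set where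
    []⇓ : ∀ {v} → [] [ v ]⇓* []
    ∷⇓  : ∀ {m} {f : Rec n} {fs : Vec (Rec n) m} {v y ys} →
          f [ v ]⇓ y → fs [ v ]⇓* ys → (f ∷ fs) [ v ]⇓* (y ∷ ys)

Total : ∀ {n} → Rec n → Set
Total r = ∀ v → ∃[ y ] r [ v ]⇓ y

-- A relation is r.e. if it is a projection { (m , n) | ∃ k. (k , m , n) ∈ T }
-- of a recursive relation T, here the zero set of a total recursive function.
RecEnum : ∀ {ℓ} → Rel ℕ ℓ → Set ℓ
RecEnum R = Σ[ r ∈ Rec 3 ] Total r ×
            (∀ m n → R m n ⇔ (∃[ k ] r [ k ∷ m ∷ n ∷ [] ]⇓ 0))

module _ (P : Poset (lsuc 0ℓ) (lsuc 0ℓ) (lsuc 0ℓ)) where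
  open Poset P

  Directed : {I : Set} → (I → Carrier) → Set (lsuc 0ℓ)
  Directed {I} s = I × (∀ i j → ∃[ k ] s i ≤ s k × s j ≤ s k)

  IsLub : {I : Set} → (I → Carrier) → Carrier → Set (lsuc 0ℓ)
  IsLub s u = (∀ i → s i ≤ u) × (∀ z → (∀ i → s i ≤ z) → u ≤ z)

-- Directed sets are presented as directed families indexed by types in Set.
-- Carriers live one universe higher, so that dcpos of continuous maps live in
-- the same universe as the given ones.  Nothing is lost for the countably based
-- dcpos below, where every directed supremum is one of a small family of basis
-- elements.
record DCPO : Set (lsuc (lsuc 0ℓ)) where
  field
    poset : Poset (lsuc 0ℓ) (lsuc 0ℓ) (lsuc 0ℓ)
  open Poset poset public renaming (_≤_ to _⊑_)
  field
    ⨆     : {I : Set} (s : I → Carrier) → Directed poset s → Carrier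
    ⨆-lub : {I : Set} (s : I → Carrier) (d : Directed poset s) →
            IsLub poset s (⨆ s d)

  _≪_ : Rel Carrier (lsuc 0ℓ)
  x ≪ y = {I : Set} (s : I → Carrier) → Directed poset s →
          ∀ u → IsLub poset s u → y ⊑ u → ∃[ i ] x ⊑ s i

infixr 0 _⟶_
record _⟶_ (X Y : DCPO) : Set (lsuc 0ℓ) where
  private
    module X = DCPO X
    module Y = DCPO Y
  field
    _$_  : X.Carrier → Y.Carrier
    mono : ∀ {x x′} → x X.⊑ x′ → _$_ x Y.⊑ _$_ x′
    cts  : {I : Set} (s : I → X.Carrier) → Directed X.poset s →
           ∀ u → IsLub X.poset s u → IsLub Y.poset (_$_ ∘ s) (_$_ u)

  directed : {I : Set} {s : I → X.Carrier} →
             Directed X.poset s → Directed Y.poset (_$_ ∘ s)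
  directed (i₀ , up) =
    i₀ , λ i j → let (k , p , q) = up i j in k , mono p , mono q

open _⟶_ public using (_$_)
open _⟶_ using (mono; cts; directed)

infixr 9 _∘ᶜ_
_∘ᶜ_ : ∀ {X Y Z} → (Y ⟶ Z) → (X ⟶ Y) → (X ⟶ Z)
_$_  (g ∘ᶜ f) x       = g $ (f $ x)
mono (g ∘ᶜ f) p       = mono g (mono f p)
cts  (g ∘ᶜ f) s d u l = cts g _ (directed f d) _ (cts f s d u l)

Fun-poset : DCPO → DCPO → Poset (lsuc 0ℓ) (lsuc 0ℓ) (lsuc 0ℓ)
Fun-poset X Y = record
  { Carrier = X ⟶ Y
  ; _≈_     = λ f g → ∀ x → (f $ x) Y.≈ (g $ x)
  ; _≤_     = λ f g → ∀ x → (f $ x) Y.⊑ (g $ x)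
  ; isPartialOrder = record
    { isPreorder = record
      { isEquivalence = record
        { refl  = λ x → Y.Eq.refl
        ; sym   = λ p x → Y.Eq.sym (p x)
        ; trans = λ p q x → Y.Eq.trans (p x) (q x)
        }
      ; reflexive = λ p x → Y.reflexive (p x)
      ; trans     = λ p q x → Y.trans (p x) (q x)
      }
    ; antisym = λ p q x → Y.antisym (p x) (q x)
    }
  }
  where module Y = DCPO Y

module _ (X Y : DCPO) where
  private
    module X = DCPO X
    module Y = DCPO Y

  at : {I : Set} (s : I → X ⟶ Y) → Directed (Fun-poset X Y) s →
       ∀ x → Directed Y.poset (λ i → s i $ x)
  at s (i₀ , up) x = i₀ , λ i j → let (k , p , q) = up i j in k , p x , q x

  ⨆ᶠ : {I : Set} (s : I → X ⟶ Y) → Directed (Fun-poset X Y) s → X ⟶ Y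
  _$_  (⨆ᶠ s d) x = Y.⨆ (λ i → s i $ x) (at s d x)
  mono (⨆ᶠ s d) {x} {x′} p =
    proj₂ (Y.⨆-lub _ (at s d x)) _
      (λ i → Y.trans (mono (s i) p) (proj₁ (Y.⨆-lub _ (at s d x′)) i))
  cts  (⨆ᶠ s d) t e u l =
      (λ j → mono (⨆ᶠ s d) (proj₁ l j))
    , λ z ub → proj₂ (Y.⨆-lub _ (at s d u)) z λ i →
        proj₂ (cts (s i) t e u l) z λ j →
          Y.trans (proj₁ (Y.⨆-lub _ (at s d (t j))) i) (ub j)

  Fun : DCPO
  Fun = record
    { poset = Fun-poset X Y
    ; ⨆     = ⨆ᶠ
    ; ⨆-lub = λ s d →
          (λ i x → proj₁ (Y.⨆-lub _ (at s d x)) i)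
        , (λ z ub x → proj₂ (Y.⨆-lub _ (at s d x)) (z $ x) (λ i → ub i x))
    }

module _ (X Y : DCPO) where
  private
    module X = DCPO X
    module Y = DCPO Y
    P = ×-poset X.poset Y.poset

  Prod : DCPO
  Prod = record
    { poset = P
    ; ⨆     = λ s d → X.⨆ (proj₁ ∘ s) (dir₁ d) , Y.⨆ (proj₂ ∘ s) (dir₂ d)
    ; ⨆-lub = λ s d →
          (λ i → proj₁ (X.⨆-lub _ (dir₁ d)) i , proj₁ (Y.⨆-lub _ (dir₂ d)) i)
        , (λ z ub → proj₂ (X.⨆-lub _ (dir₁ d)) _ (proj₁ ∘ ub)
                  , proj₂ (Y.⨆-lub _ (dir₂ d)) _ (proj₂ ∘ ub))
    }
    where
    dir₁ : {I : Set} {s : I → Poset.Carrier P} →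
           Directed P s → Directed X.poset (proj₁ ∘ s)
    dir₁ (i₀ , up) =
      i₀ , λ i j → let (k , p , q) = up i j in k , proj₁ p , proj₁ q
    dir₂ : {I : Set} {s : I → Poset.Carrier P} →
           Directed P s → Directed Y.poset (proj₂ ∘ s)
    dir₂ (i₀ , up) =
      i₀ , λ i j → let (k , p , q) = up i j in k , proj₂ p , proj₂ q

  fst : Prod ⟶ X
  _$_  fst = proj₁
  mono fst = proj₁
  cts  fst s d u (ub , least) =
    proj₁ ∘ ub ,
    λ z h → proj₁ (least (z , proj₂ u) (λ i → h i , proj₂ (ub i)))

  snd : Prod ⟶ Y
  _$_  snd = proj₂
  mono snd = proj₂
  cts  snd s d u (ub , least) =
    proj₂ ∘ ub ,
    λ z h → proj₂ (least (proj₁ u , z) (λ i → proj₁ (ub i) , h i))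

  curry : (Z : DCPO) → Prod ⟶ Z → X ⟶ Fun Y Z
  curry Z f = curried
    where
    module Z = DCPO Z
    section : X.Carrier → Y ⟶ Z
    _$_  (section x) y = f $ (x , y)
    mono (section x) p = mono f (X.refl , p)
    cts  (section x) s (i₀ , up) u (ub , least) =
      cts f (λ i → x , s i)
        (i₀ , λ i j → let (k , p , q) = up i j in k , (X.refl , p) , (X.refl , q))
        (x , u)
        ((λ i → X.refl , ub i) , λ z h → proj₁ (h i₀) , least _ (proj₂ ∘ h))
    curried : X ⟶ Fun Y Z
    _$_  curried = section
    mono curried p y = mono f (p , Y.refl)
    cts  curried s (i₀ , up) u (ub , least) =
        (λ i y → mono f (ub i , Y.refl))
      , λ g h y → proj₂
          (cts f (λ i → s i , y)
            (i₀ , λ i j → let (k , p , q) = up i j in k , (p , Y.refl) , (q , Y.refl))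
            (u , y)
            ((λ i → ub i , Y.refl) , λ z h′ → least _ (proj₁ ∘ h′) , proj₂ (h′ i₀)))
          (g $ y) (λ i → h i y)

⟨_,_⟩ : ∀ {W X Y} → (W ⟶ X) → (W ⟶ Y) → W ⟶ Prod X Y
_$_  ⟨ f , g ⟩ w = f $ w , g $ w
mono ⟨ f , g ⟩ p = mono f p , mono g p
cts  ⟨ f , g ⟩ s d u l =
    (λ i → proj₁ (cts f s d u l) i , proj₁ (cts g s d u l) i)
  , (λ z h → proj₂ (cts f s d u l) _ (proj₁ ∘ h)
           , proj₂ (cts g s d u l) _ (proj₂ ∘ h))

eval : ∀ X Y → Prod (Fun X Y) X ⟶ Y
eval X Y = ev
  where
  module X = DCPO X
  module Y = DCPO Y
  module F = DCPO (Fun X Y)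
  ev : Prod (Fun X Y) X ⟶ Y
  _$_  ev (f , x) = f $ x
  mono ev {f , x} {f′ , x′} (p , q) = Y.trans (mono f q) (p x′)
  cts  ev s d (g , u) l =
      (λ i → mono ev {s i} {g , u} (proj₁ l i))
    , λ z h →
        let dF = directed (fst (Fun X Y) X) {s = s} d
            lF = cts (fst (Fun X Y) X) s d (g , u) l
            dX = directed (snd (Fun X Y) X) {s = s} d
            lX = cts (snd (Fun X Y) X) s d (g , u) l
        in Y.trans
             (proj₂ lF (F.⨆ (proj₁ ∘ s) dF) (proj₁ (F.⨆-lub (proj₁ ∘ s) dF)) u)
             (proj₂ (Y.⨆-lub _ (at X Y (proj₁ ∘ s) dF u)) z λ i →
               proj₂ (cts (proj₁ (s i)) (proj₂ ∘ s) dX u lX) z λ j →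
                 let (k , p , q) = proj₂ d i j
                 in Y.trans (Y.trans (mono (proj₁ (s i)) (proj₂ q)) (proj₁ p _)) (h k))

One : DCPO
One = record
  { poset = ≡-poset (lsuc 0ℓ)
  ; ⨆     = λ _ _ → tt
  ; ⨆-lub = λ _ _ → (λ _ → refl) , (λ _ _ → refl)
  }

! : ∀ X → X ⟶ One
_$_  (! X) _ = tt
mono (! X) _ = refl
cts  (! X) _ _ _ _ = (λ _ → refl) , (λ _ _ → refl)

-- The flat domain of A consists of the subsets of A with at most one element,
-- ordered by inclusion; the empty one is the bottom element.  (The disjoint sum
-- of A with a bottom element is directed complete only if one assumes a form of
-- excluded middle, under which it is isomorphic to Flat A; see Flat-cases.)
record Partial (A : Set) : Set (lsuc 0ℓ) where
  field
    _∋_    : A → Set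
    unique : ∀ {a b} → _∋_ a → _∋_ b → a ≡ b
open Partial

-- A record, in order to raise the universe level.
record _⊆ᶠ_ {A : Set} (x y : Partial A) : Set (lsuc 0ℓ) where
  constructor incl
  field sub : ∀ {a} → x ∋ a → y ∋ a
open _⊆ᶠ_

Flat : Set → DCPO
Flat A = record
  { poset = record
    { Carrier = Partial A
    ; _≈_     = λ x y → x ⊆ᶠ y × y ⊆ᶠ x
    ; _≤_     = _⊆ᶠ_
    ; isPartialOrder = record
      { isPreorder = record
        { isEquivalence = record
          { refl  = rfl , rfl
          ; sym   = λ (p , q) → q , p
          ; trans = λ (p , q) (p′ , q′) → trs p p′ , trs q′ q
          }
        ; reflexive = proj₁
        ; trans     = trs
        }
      ; antisym = _,_
      }
    }
  ; ⨆     = λ {I} s d → record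
    { _∋_    = λ a → Σ[ i ∈ I ] s i ∋ a
    ; unique = λ (i , p) (j , q) →
        let (k , ik , jk) = proj₂ d i j in unique (s k) (sub ik p) (sub jk q)
    }
  ; ⨆-lub = λ s d → (λ i → incl (i ,_)) , (λ z h → incl (λ (i , p) → sub (h i) p))
  }
  where
  rfl : {x : Partial A} → x ⊆ᶠ x
  rfl = incl (λ p → p)
  trs : {x y z : Partial A} → x ⊆ᶠ y → y ⊆ᶠ z → x ⊆ᶠ z
  trs p q = incl (sub q ∘ sub p)

bot : ∀ {A} → Partial A
bot = record { _∋_ = λ _ → ⊥ ; unique = λ () }

η : ∀ {A} → A → Partial A
η a = record { _∋_ = λ b → a ≡ b ; unique = λ { refl refl → refl } }

Flat-cases : ∀ {A} (x : Partial A) → let open DCPO (Flat A) using (_≈_) in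
             ¬ ¬ (x ≈ bot ⊎ (∃[ a ] x ≈ η a))
Flat-cases x k = k (inj₁ (incl none , incl (λ ())))
  where
  none : ∀ {a} → x ∋ a → ⊥
  none {a} p = k (inj₂ (a , incl (unique x p) , incl (λ a≡b → subst (x ∋_) a≡b p)))

𝟘 𝟙 : Partial Bool
𝟘 = η false
𝟙 = η true

-- An effective presentation of a continuous dcpo: an enumerated basis on which
-- the way-below relation is r.e.  For algebraic dcpos with the compact elements
-- as basis, way-below is the order on the basis.
record Effective (X : DCPO) : Set (lsuc 0ℓ) where
  open DCPO X
  field
    b     : ℕ → Carrier
    basis : ∀ x → Σ[ I ∈ Set ] Σ[ s ∈ (I → ℕ) ]
              (∀ i → b (s i) ≪ x) × Directed poset (b ∘ s) × IsLub poset (b ∘ s) x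
    ≪-re  : RecEnum (λ m n → b m ≪ b n)

record Domain : Set (lsuc (lsuc 0ℓ)) where
  constructor _,ᵉ_
  field
    dcpo      : DCPO
    effective : Effective dcpo
  open DCPO dcpo public
  open Effective effective public
open Domain using (dcpo)

Computable : (D E : Domain) → (dcpo D ⟶ dcpo E) → Set (lsuc 0ℓ)
Computable D E f = RecEnum (λ m n → E.b n E.≪ (f $ D.b m))
  where
  module D = Domain D
  module E = Domain E

-- A cartesian closed category of effectively given domains and computable maps,
-- containing the flat domain of booleans.  It is given by a class of effectively
-- given domains (IsObj may carry further structure, such as algebraicity, bounded
-- completeness and decidable consistency).  Products and exponentials are the
-- cartesian product and the dcpo of continuous maps, with presentations
-- making the categorical operations computable.
record EffectiveCCC (ℓ : Level) : Set (lsuc (lsuc 0ℓ) ⊔ lsuc ℓ) where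
  field
    IsObj : Domain → Set ℓ

  Obj : Set (lsuc (lsuc 0ℓ) ⊔ ℓ)
  Obj = Σ Domain IsObj

  ⟦_⟧ : Obj → DCPO
  ⟦ D ⟧ = dcpo (proj₁ D)

  IsComputable : (D E : Obj) → (⟦ D ⟧ ⟶ ⟦ E ⟧) → Set (lsuc 0ℓ)
  IsComputable D E = Computable (proj₁ D) (proj₁ E)

  field
    one-eff  : Effective One
    one-obj  : IsObj (One ,ᵉ one-eff)
    prod-eff : (D E : Obj) → Effective (Prod ⟦ D ⟧ ⟦ E ⟧)
    prod-obj : ∀ D E → IsObj (Prod ⟦ D ⟧ ⟦ E ⟧ ,ᵉ prod-eff D E)
    fun-eff  : (D E : Obj) → Effective (Fun ⟦ D ⟧ ⟦ E ⟧)
    fun-obj  : ∀ D E → IsObj (Fun ⟦ D ⟧ ⟦ E ⟧ ,ᵉ fun-eff D E)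
    bool-eff : Effective (Flat Bool)
    bool-obj : IsObj (Flat Bool ,ᵉ bool-eff)

  𝟏 : Obj
  𝟏 = _ , one-obj

  𝓑 : Obj
  𝓑 = _ , bool-obj

  infixr 6 _⊗_
  _⊗_ : Obj → Obj → Obj
  D ⊗ E = _ , prod-obj D E

  infixr 5 _⇒_
  _⇒_ : Obj → Obj → Obj
  D ⇒ E = _ , fun-obj D E

  field
    !-computable     : ∀ D → IsComputable D 𝟏 (! ⟦ D ⟧)
    fst-computable   : ∀ D E → IsComputable (D ⊗ E) D (fst ⟦ D ⟧ ⟦ E ⟧)
    snd-computable   : ∀ D E → IsComputable (D ⊗ E) E (snd ⟦ D ⟧ ⟦ E ⟧)
    pair-computable  : ∀ C D E f g → IsComputable C D f → IsComputable C E g →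
                       IsComputable C (D ⊗ E) ⟨ f , g ⟩
    eval-computable  : ∀ D E → IsComputable ((D ⇒ E) ⊗ D) E (eval ⟦ D ⟧ ⟦ E ⟧)
    curry-computable : ∀ C D E f → IsComputable (C ⊗ D) E f →
                       IsComputable C (D ⇒ E) (curry ⟦ C ⟧ ⟦ D ⟧ ⟦ E ⟧ f)

open DCPO using (Carrier)

record Subset (X : DCPO) : Set (lsuc (lsuc 0ℓ)) where
  open DCPO X using (_≈_)
  field
    mem  : Pred (Carrier X) (lsuc 0ℓ)
    resp : ∀ {x y} → x ≈ y → mem x → mem y

infix 4 _∈_
_∈_ : ∀ {X} → Carrier X → Subset X → Set (lsuc 0ℓ)
x ∈ K = Subset.mem K x

image : ∀ {X Y} → (X ⟶ Y) → Subset X → Subset Y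
image {X} {Y} f K = record
  { mem  = λ y → ∃[ x ] x ∈ K × (f $ x) ≈ y
  ; resp = λ y≈y′ (x , x∈K , fx≈y) → x , x∈K , Eq.trans fx≈y y≈y′
  }
  where open DCPO Y

module _ {ℓ} (C : EffectiveCCC ℓ) where
  open EffectiveCCC C
  open DCPO (Flat Bool) using (_≈_)

  DefinedOn : ∀ {D} → Subset ⟦ D ⟧ → Carrier ⟦ D ⇒ 𝓑 ⟧ → Set (lsuc 0ℓ)
  DefinedOn K p = ∀ x → x ∈ K → ¬ (p $ x) ≈ bot

  Exhaustible : (D : Obj) → Subset ⟦ D ⟧ → Set (lsuc 0ℓ)
  Exhaustible D K =
    Σ[ A ∈ (⟦ D ⇒ 𝓑 ⟧ ⟶ ⟦ 𝓑 ⟧) ] IsComputable (D ⇒ 𝓑) 𝓑 A ×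
      (∀ p → DefinedOn {D} K p →
        ((∀ x → x ∈ K → (p $ x) ≈ 𝟙) → (A $ p) ≈ 𝟙) ×
        ((∃[ x ] x ∈ K × (p $ x) ≈ 𝟘) → (A $ p) ≈ 𝟘))

  Searchable : (D : Obj) → Subset ⟦ D ⟧ → Set (lsuc 0ℓ)
  Searchable D K =
    Σ[ ε ∈ (⟦ D ⇒ 𝓑 ⟧ ⟶ ⟦ D ⟧) ] IsComputable (D ⇒ 𝓑) D ε ×
      (∀ p → DefinedOn {D} K p →
        (ε $ p) ∈ K ×
        ((∃[ x ] x ∈ K × (p $ x) ≈ 𝟙) → (p $ (ε $ p)) ≈ 𝟙))

{-# OPTIONS --safe #-}

-- Precomposition with f is a computable map f* : (D′ ⇒ 𝓑) ⟶ (D ⇒ 𝓑), so A ∘ f*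
-- quantifies over f(K) and f ∘ ε ∘ f* searches f(K).  What takes work is that
-- computable maps compose: c ≪ g (f x) holds iff c ≪ g b and b ≪ f x for some
-- basis element b, by interpolation, and r.e. relations compose.
module Submission where

open import Data.Fin.Base using (Fin)
open import Data.Fin.Patterns using (0F; 1F; 2F; 3F; 4F)
open import Data.Nat.Base using (ℕ; zero; suc; _+_; _<_; s≤s)
open import Data.Nat.Properties
  using (<-cmp; m<n⇒m<1+n; n<1+n; ≤-trans; m≤m+n; m≤n+m; m<1+n⇒m<n∨m≡n)
open import Data.Product.Base using (Σ-syntax; ∃-syntax; _×_; _,_; proj₁; proj₂)
open import Data.Sum.Base using (_⊎_; inj₁; inj₂)
open import Data.Unit.Base using (⊤)
open import Data.Vec.Base using (Vec; []; _∷_; head; tail; lookup; map; tabulate)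
open import Data.Vec.Properties using (tabulate∘lookup; tabulate-∘)
open import Function.Base using (_∘_)
open import Function.Bundles using (_⇔_; mk⇔; Equivalence)
open import Function.Properties.Equivalence using ()
  renaming (sym to ⇔-sym; trans to ⇔-trans)
open import Relation.Binary.Core using (Rel)
open import Relation.Binary.Definitions using (tri<; tri≈; tri>)
open import Relation.Binary.PropositionalEquality using (_≡_; refl; sym; subst)

open import Defs
open Equivalence using (to; from)
open _⟶_ using (mono; cts; directed)

-- Evaluation of codes and recursive predicates.

mutual
  ⇓-deterministic : ∀ {n} {r : Rec n} {v y z} → r [ v ]⇓ y → r [ v ]⇓ z → y ≡ z
  ⇓-deterministic zer⇓ zer⇓ = refl
  ⇓-deterministic succ⇓ succ⇓ = refl
  ⇓-deterministic (proj⇓ i) (proj⇓ .i) = refl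
  ⇓-deterministic (comp⇓ gs f) (comp⇓ gs′ f′) with ⇓*-deterministic gs gs′
  ... | refl = ⇓-deterministic f f′
  ⇓-deterministic (prec⇓₀ f) (prec⇓₀ f′) = ⇓-deterministic f f′
  ⇓-deterministic (prec⇓ₛ p g) (prec⇓ₛ p′ g′) with ⇓-deterministic p p′
  ... | refl = ⇓-deterministic g g′
  ⇓-deterministic (mu⇓ {x = x} below f) (mu⇓ {x = x′} below′ f′) with <-cmp x x′
  ... | tri≈ _ x≡x′ _ = x≡x′
  -- At the smaller of two distinct values the code would evaluate both to 0 and to a successor.
  ... | tri< x<x′ _ _ with () ← ⇓-deterministic f (proj₂ (below′ x x<x′))
  ... | tri> _ _ x′<x with () ← ⇓-deterministic (proj₂ (below x′ x′<x)) f′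

  ⇓*-deterministic : ∀ {m n} {rs : Vec (Rec n) m} {v ys zs} →
                     rs [ v ]⇓* ys → rs [ v ]⇓* zs → ys ≡ zs
  ⇓*-deterministic []⇓ []⇓ = refl
  ⇓*-deterministic (∷⇓ f fs) (∷⇓ f′ fs′)
    with ⇓-deterministic f f′ | ⇓*-deterministic fs fs′
  ... | refl | refl = refl

-- Truth is the value 0, as in `RecEnum`. Keeping `char` beside `code` lets logical facts be proved
-- about an ordinary function, apart from derivations.
record Recursive {n} (P : Vec ℕ n → Set) : Set where
  field
    code     : Rec n
    char     : Vec ℕ n → ℕ
    computes : ∀ v → code [ v ]⇓ char v
    zeros    : ∀ v → char v ≡ 0 ⇔ P v

  code-total : Total code
  code-total v = char v , computes v

  code-zeros : ∀ v → code [ v ]⇓ 0 ⇔ P v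
  code-zeros v = mk⇔
    (to (zeros v) ∘ ⇓-deterministic (computes v))
    (λ p → subst (code [ v ]⇓_) (from (zeros v) p) (computes v))

open Recursive

zero-set : ∀ {n} (r : Rec n) → Total r → Recursive (λ v → r [ v ]⇓ 0)
zero-set r total = record
  { code     = r
  ; char     = proj₁ ∘ total
  ; computes = proj₂ ∘ total
  ; zeros    = λ v → mk⇔
      (λ eq → subst (r [ v ]⇓_) eq (proj₂ (total v)))
      (⇓-deterministic (proj₂ (total v)))
  }

projections⇓ : ∀ {m n} (ρ : Vec (Fin n) m) (v : Vec ℕ n) →
               map proj ρ [ v ]⇓* map (lookup v) ρ
projections⇓ []      v = []⇓
projections⇓ (i ∷ ρ) v = ∷⇓ (proj⇓ i) (projections⇓ ρ v)

-- Composition with projections covers weakening, permutation and, through repeated indices in `ρ`,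
-- duplication of variables.
reindex : ∀ {m n} (ρ : Vec (Fin n) m) {P : Vec ℕ m → Set} →
          Recursive P → Recursive (λ v → P (map (lookup v) ρ))
reindex ρ R = record
  { code     = comp (code R) (map proj ρ)
  ; char     = λ v → char R (map (lookup v) ρ)
  ; computes = λ v → comp⇓ (projections⇓ ρ v) (computes R _)
  ; zeros    = λ v → zeros R _
  }

and : ℕ → ℕ → ℕ
and zero    y = y
and (suc x) y = suc x

-- The step function of `prec` receives the predecessor, the previous value and the parameters, in
-- this order: hence the successor of `proj 0F` here and `proj 2F` in `orᶜ`.
andᶜ : Rec 2
andᶜ = prec (proj 0F) (comp succ (proj 0F ∷ []))

andᶜ⇓ : ∀ x y → andᶜ [ x ∷ y ∷ [] ]⇓ and x y
andᶜ⇓ zero    y = prec⇓₀ (proj⇓ 0F)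
andᶜ⇓ (suc x) y = prec⇓ₛ (andᶜ⇓ x y) (comp⇓ (∷⇓ (proj⇓ 0F) []⇓) succ⇓)

and-zero : ∀ x y → and x y ≡ 0 ⇔ (x ≡ 0 × y ≡ 0)
and-zero zero    y = mk⇔ (refl ,_) proj₂
and-zero (suc x) y = mk⇔ (λ ()) (λ ())

or : ℕ → ℕ → ℕ
or zero    y = 0
or (suc x) y = y

orᶜ : Rec 2
orᶜ = prec zer (proj 2F)

orᶜ⇓ : ∀ x y → orᶜ [ x ∷ y ∷ [] ]⇓ or x y
orᶜ⇓ zero    y = prec⇓₀ zer⇓
orᶜ⇓ (suc x) y = prec⇓ₛ (orᶜ⇓ x y) (proj⇓ 2F)

or-zero : ∀ x y → or x y ≡ 0 ⇔ (x ≡ 0 ⊎ y ≡ 0)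
or-zero zero    y = mk⇔ (λ _ → inj₁ refl) (λ _ → refl)
or-zero (suc x) y = mk⇔ inj₂ (λ { (inj₁ ()) ; (inj₂ eq) → eq })

conjunction : ∀ {n} {P Q : Vec ℕ n → Set} →
              Recursive P → Recursive Q → Recursive (λ v → P v × Q v)
conjunction R S = record
  { code     = comp andᶜ (code R ∷ code S ∷ [])
  ; char     = λ v → and (char R v) (char S v)
  ; computes = λ v →
      comp⇓ (∷⇓ (computes R v) (∷⇓ (computes S v) []⇓)) (andᶜ⇓ _ _)
  ; zeros    = λ v → ⇔-trans (and-zero _ _) (mk⇔
      (λ (p , q) → to (zeros R v) p , to (zeros S v) q)
      (λ (p , q) → from (zeros R v) p , from (zeros S v) q))
  }

-- A search below a bound is a primitive recursion over the characteristic function, so unlike `mu`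
-- it stays total. The bound is the head because `prec` recurses on the first argument.
bounded-∃ : ∀ {n} {P : Vec ℕ (suc n) → Set} → Recursive P →
            Recursive (λ v → ∃[ i ] i < head v × P (i ∷ tail v))
bounded-∃ {n} {P} R = record
  { code     = search
  ; char     = λ v → found (head v) (tail v)
  ; computes = λ { (w ∷ v) → search⇓ w v }
  ; zeros    = λ { (w ∷ v) → found-zero w v }
  }
  where
  found : ℕ → Vec ℕ n → ℕ
  -- No index lies below 0, so the search starts from falsity.
  found zero    v = 1
  found (suc x) v = or (char R (x ∷ v)) (found x v)

  -- Leaves out position 1, which holds the outcome of the search so far.
  skip : ∀ {n} → Vec (Fin (suc (suc n))) (suc n)
  skip = 0F ∷ tabulate (Fin.suc ∘ Fin.suc)

  search : Rec (suc n)
  search = prec (comp succ (zer ∷ []))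
                (comp orᶜ (comp (code R) (map proj skip) ∷ proj 1F ∷ []))

  skip-lookup : ∀ x y (v : Vec ℕ n) → map (lookup (x ∷ y ∷ v)) skip ≡ x ∷ v
  skip-lookup x y v
    rewrite sym (tabulate-∘ (lookup (x ∷ y ∷ v)) (Fin.suc ∘ Fin.suc)) | tabulate∘lookup v
    = refl

  search⇓ : ∀ x v → search [ x ∷ v ]⇓ found x v
  search⇓ zero    v = prec⇓₀ (comp⇓ (∷⇓ zer⇓ []⇓) succ⇓)
  search⇓ (suc x) v = prec⇓ₛ (search⇓ x v)
    (comp⇓ (∷⇓ (comp⇓ (subst (map proj skip [ x ∷ found x v ∷ v ]⇓*_) (skip-lookup x (found x v) v)
                              (projections⇓ skip _))
                      (computes R (x ∷ v)))
           (∷⇓ (proj⇓ 1F) []⇓))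
      (orᶜ⇓ _ _))

  found-zero : ∀ w v → found w v ≡ 0 ⇔ (∃[ i ] i < w × P (i ∷ v))
  found-zero zero    v = mk⇔ (λ ()) (λ ())
  found-zero (suc w) v = ⇔-trans (or-zero _ _) (mk⇔
    (λ { (inj₁ eq) → w , n<1+n w , to (zeros R _) eq
       ; (inj₂ eq) → let (i , i<w , p) = to (found-zero w v) eq
                     in i , m<n⇒m<1+n i<w , p })
    (λ (i , i<1+w , p) → below i p (m<1+n⇒m<n∨m≡n i<1+w)))
    where
    below : ∀ i → P (i ∷ v) → i < w ⊎ i ≡ w →
            char R (w ∷ v) ≡ 0 ⊎ found w v ≡ 0
    below i p (inj₁ i<w)  = inj₂ (from (found-zero w v) (i , i<w , p))
    below i p (inj₂ refl) = inj₁ (from (zeros R _) p)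

-- Recursively enumerable relations.

RecEnum-resp-⇔ : ∀ {ℓ ℓ′} {R : Rel ℕ ℓ} {S : Rel ℕ ℓ′} →
                 (∀ m n → R m n ⇔ S m n) → RecEnum R → RecEnum S
RecEnum-resp-⇔ R⇔S (r , total , spec) =
  r , total , λ m n → ⇔-trans (⇔-sym (R⇔S m n)) (spec m n)

RecEnum-compose : ∀ {ℓ ℓ′} {R : Rel ℕ ℓ} {S : Rel ℕ ℓ′} → RecEnum R → RecEnum S →
                  RecEnum (λ m n → ∃[ k ] R m k × S k n)
RecEnum-compose {R = R} {S} (r , r-total , r-spec) (s , s-total , s-spec) =
  code bounded , code-total bounded , λ m n → mk⇔
    (λ (k , Rmk , Skn) →
      let (a , r♭) = to (r-spec m k) Rmk
          (b , s♭) = to (s-spec k n) Skn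
      -- The successor makes this common bound strict.
      in suc (a + (b + k)) , from (code-zeros bounded _)
        ( a , s≤s (m≤m+n a (b + k))
        , b , s≤s (≤-trans (m≤m+n b k) (m≤n+m (b + k) a))
        , k , s≤s (≤-trans (m≤n+m k b) (m≤n+m (b + k) a))
        , r♭ , s♭))
    (λ (w , d) →
      let (a , _ , b , _ , k , _ , r♭ , s♭) = to (code-zeros bounded _) d
      in k , from (r-spec m k) (a , r♭) , from (s-spec k n) (b , s♭))
  where
  -- A single witness w for three existential quantifiers, without a pairing
  -- function: it bounds all of them, as in
  --   ∃ a < w. ∃ b < w. ∃ k < w. r(a , m , k) = 0 ∧ s(b , k , n) = 0.
  -- The innermost variables are listed in the order (k , b , a , m , n).
  bounded =
    reindex (0F ∷ 0F ∷ 1F ∷ 2F ∷ []) (bounded-∃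
      (reindex (1F ∷ 1F ∷ 0F ∷ 2F ∷ 3F ∷ []) (bounded-∃
        (reindex (1F ∷ 0F ∷ 2F ∷ 3F ∷ 4F ∷ []) (bounded-∃
          (conjunction
            (reindex (2F ∷ 3F ∷ 0F ∷ []) (zero-set r r-total))
            (reindex (1F ∷ 0F ∷ 4F ∷ []) (zero-set s s-total))))))))

-- The way-below relation.

module _ (X : DCPO) where
  open DCPO X

  -- `y` is the supremum of the constant family at `y`, indexed by one point.
  ≪⇒⊑ : ∀ {x y} → x ≪ y → x ⊑ y
  ≪⇒⊑ {y = y} x≪y = proj₂ (x≪y {⊤} (λ _ → y) (_ , λ _ _ → _ , refl⊑ , refl⊑) y
    ((λ _ → refl⊑) , (λ z ub → ub _)) refl⊑)
    where refl⊑ = reflexive Eq.refl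

  ≪-⊑-trans : ∀ {x y z} → x ≪ y → y ⊑ z → x ≪ z
  ≪-⊑-trans x≪y y⊑z s d u l z⊑u = x≪y s d u l (trans y⊑z z⊑u)

  ⊑-≪-trans : ∀ {x y z} → x ⊑ y → y ≪ z → x ≪ z
  ⊑-≪-trans x⊑y y≪z s d u l z⊑u =
    let (i , y⊑sᵢ) = y≪z s d u l z⊑u in i , trans x⊑y y⊑sᵢ

  -- The basis elements way below a basis element way below y form a directed
  -- family with supremum y.
  ≪-interpolate : (e : Effective X) → let open Effective e in
                  ∀ {x y} → x ≪ y → ∃[ j ] x ≪ b j × b j ≪ y
  ≪-interpolate e {x} {y} x≪y with Effective.basis e y
  ... | I , s , s≪y , (i₀ , up) , (ub , least) =
    let ((i , j) , x⊑t) = x≪y t t-directed y t-lub (reflexive Eq.refl)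
    in s i , ⊑-≪-trans x⊑t (below≪ i j) , s≪y i
    where
    open Effective e
    J : I → Set
    J i = proj₁ (basis (b (s i)))
    below : ∀ i → J i → ℕ
    below i = proj₁ (proj₂ (basis (b (s i))))
    below≪ : ∀ i j → b (below i j) ≪ b (s i)
    below≪ i = proj₁ (proj₂ (proj₂ (basis (b (s i)))))
    below-directed : ∀ i → Directed poset (b ∘ below i)
    below-directed i = proj₁ (proj₂ (proj₂ (proj₂ (basis (b (s i))))))
    below-lub : ∀ i → IsLub poset (b ∘ below i) (b (s i))
    below-lub i = proj₂ (proj₂ (proj₂ (proj₂ (basis (b (s i))))))

    t : Σ[ i ∈ I ] J i → Carrier
    t (i , j) = b (below i j)

    t-directed : Directed poset t
    t-directed = (i₀ , proj₁ (below-directed i₀)) , λ (i , j) (i′ , j′) →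
      let (k , p , p′) = up i i′
          -- Both elements are way below something under `b (s k)`, so each already lies under a
          -- member of the directed family approximating `b (s k)`.
          (l , q)   = below≪ i j (b ∘ below k) (below-directed k) _ (below-lub k) p
          (l′ , q′) = below≪ i′ j′ (b ∘ below k) (below-directed k) _ (below-lub k) p′
          (m , r , r′) = proj₂ (below-directed k) l l′
      in (k , m) , trans q r , trans q′ r′

    t-lub : IsLub poset t y
    t-lub = (λ (i , j) → trans (≪⇒⊑ (below≪ i j)) (ub i))
          , λ z h → least z λ i → proj₂ (below-lub i) z λ j → h (i , j)

-- Composition of computable maps.

∘-computable : ∀ (X Y Z : Domain) g f → Computable Y Z g → Computable X Y f →
               Computable X Z (g ∘ᶜ f)
∘-computable X Y Z g f g-comp f-comp =
  RecEnum-resp-⇔ (λ m n → mk⇔ (compose m n) (split m n)) (RecEnum-compose f-comp g-comp)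
  where
  module X = Domain X
  module Y = Domain Y
  module Z = Domain Z
  compose : ∀ m n → (∃[ k ] Y.b k Y.≪ (f $ X.b m) × Z.b n Z.≪ (g $ Y.b k)) →
            Z.b n Z.≪ (g $ (f $ X.b m))
  compose m n (k , p , q) = ≪-⊑-trans Z.dcpo {Z.b n} q (mono g (≪⇒⊑ Y.dcpo p))

  split : ∀ m n → Z.b n Z.≪ (g $ (f $ X.b m)) →
          ∃[ k ] Y.b k Y.≪ (f $ X.b m) × Z.b n Z.≪ (g $ Y.b k)
  split m n p =
    -- By continuity, `g` maps the approximants of `f x` to a directed family with supremum
    -- `g (f x)`. Applying `p` to it directly would give only an inequality with some member; the
    -- interpolant restores way-below.
    let (j , p₁ , p₂) = ≪-interpolate Z.dcpo Z.effective {Z.b n} p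
        (I , s , s≪ , d , l) = Y.basis (f $ X.b m)
        (i , q) = p₂ _ (directed g d) _ (cts g _ d _ l) (Z.reflexive Z.Eq.refl)
    in s i , s≪ i , ≪-⊑-trans Z.dcpo {Z.b n} p₁ q

$-cong : ∀ {X Y} (f : X ⟶ Y) {x x′} → DCPO._≈_ X x x′ → DCPO._≈_ Y (f $ x) (f $ x′)
$-cong {X} {Y} f x≈x′ =
  DCPO.antisym Y (mono f (reflexive x≈x′)) (mono f (reflexive (Eq.sym x≈x′)))
  where open DCPO X

-- Precomposition in the cartesian closed category.

module _ {ℓ} (C : EffectiveCCC ℓ) where
  open EffectiveCCC C

  ∘-closed : ∀ D E F g f → IsComputable E F g → IsComputable D E f →
             IsComputable D F (g ∘ᶜ f)
  ∘-closed D E F = ∘-computable (proj₁ D) (proj₁ E) (proj₁ F)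

  module _ (D D′ E : Obj) (f : ⟦ D ⟧ ⟶ ⟦ D′ ⟧) where
    private
      P : Obj
      P = (D′ ⇒ E) ⊗ D

      function : ⟦ P ⟧ ⟶ ⟦ D′ ⇒ E ⟧
      function = fst ⟦ D′ ⇒ E ⟧ ⟦ D ⟧

      argument : ⟦ P ⟧ ⟶ ⟦ D ⟧
      argument = snd ⟦ D′ ⇒ E ⟧ ⟦ D ⟧

      apply : ⟦ P ⟧ ⟶ ⟦ E ⟧
      apply = eval ⟦ D′ ⟧ ⟦ E ⟧ ∘ᶜ ⟨ function , f ∘ᶜ argument ⟩

    -- As the transpose of the map sending `(h , x)` to `h (f x)`, it is assembled from categorical
    -- operations whose computability is given.
    precompose : ⟦ D′ ⇒ E ⟧ ⟶ ⟦ D ⇒ E ⟧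
    precompose = curry ⟦ D′ ⇒ E ⟧ ⟦ D ⟧ ⟦ E ⟧ apply

    precompose-computable : IsComputable D D′ f →
                            IsComputable (D′ ⇒ E) (D ⇒ E) precompose
    precompose-computable f-comp =
      curry-computable (D′ ⇒ E) D E apply
        (∘-closed P ((D′ ⇒ E) ⊗ D′) E (eval ⟦ D′ ⟧ ⟦ E ⟧) ⟨ function , f ∘ᶜ argument ⟩
          (eval-computable D′ E)
          (pair-computable P (D′ ⇒ E) D′ function (f ∘ᶜ argument)
            (fst-computable (D′ ⇒ E) D)
            (∘-closed P D D′ f argument f-comp (snd-computable (D′ ⇒ E) D))))

-- Transfer of quantification and search to the image.

proposition4p3 : ∀ {ℓ} (C : EffectiveCCC ℓ) → let open EffectiveCCC C in
    (D D′ : Obj) (f : ⟦ D ⟧ ⟶ ⟦ D′ ⟧) → IsComputable D D′ f →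
    (K : Subset ⟦ D ⟧) →
    (Exhaustible C D K → Exhaustible C D′ (image f K)) ×
    (Searchable C D K → Searchable C D′ (image f K))
proposition4p3 C D D′ f f-comp K = exhaust , search
  where
  open EffectiveCCC C
  module D′ = DCPO ⟦ D′ ⟧
  module 𝓑 = DCPO ⟦ 𝓑 ⟧

  f* : ⟦ D′ ⇒ 𝓑 ⟧ ⟶ ⟦ D ⇒ 𝓑 ⟧
  f* = precompose C D D′ 𝓑 f

  f*-computable : IsComputable (D′ ⇒ 𝓑) (D ⇒ 𝓑) f*
  f*-computable = precompose-computable C D D′ 𝓑 f f-comp

  f∈ : ∀ {x} → x ∈ K → (f $ x) ∈ image f K
  f∈ x∈K = _ , x∈K , D′.Eq.refl

  -- Membership in the image holds up to `≈`, so the value of `p` at `y` is carried to `f x` by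
  -- congruence. `exhaust` takes `a` to be `𝟘`, `search` takes it to be `𝟙`.
  restrict : ∀ (p : ⟦ D′ ⟧ ⟶ ⟦ 𝓑 ⟧) {a : 𝓑.Carrier} →
             (∃[ y ] y ∈ image f K × (p $ y) 𝓑.≈ a) →
             ∃[ x ] x ∈ K × ((f* $ p) $ x) 𝓑.≈ a
  restrict p (y , (x , x∈K , fx≈y) , py≈a) =
    x , x∈K , 𝓑.Eq.trans ($-cong p fx≈y) py≈a

  exhaust : Exhaustible C D K → Exhaustible C D′ (image f K)
  exhaust (A , A-comp , spec) =
    A ∘ᶜ f* ,
    ∘-closed C (D′ ⇒ 𝓑) (D ⇒ 𝓑) 𝓑 A f* A-comp f*-computable ,
    λ p defined →
      let (all , some) = spec (f* $ p) (λ x x∈K → defined (f $ x) (f∈ x∈K))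
      in (λ h → all (λ x x∈K → h (f $ x) (f∈ x∈K))) , (λ h → some (restrict p h))

  search : Searchable C D K → Searchable C D′ (image f K)
  search (ε , ε-comp , spec) =
    f ∘ᶜ (ε ∘ᶜ f*) ,
    ∘-closed C (D′ ⇒ 𝓑) D D′ f (ε ∘ᶜ f*) f-comp
      (∘-closed C (D′ ⇒ 𝓑) (D ⇒ 𝓑) D ε f* ε-comp f*-computable) ,
    λ p defined →
      let (εp∈K , found) = spec (f* $ p) (λ x x∈K → defined (f $ x) (f∈ x∈K))
      -- `p` at `f (ε (f* p))` is by definition `f* p` at `ε (f* p)`, so `found` already concerns
      -- the required value.
      in f∈ εp∈K , (λ h → found (restrict p h))
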